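{- Let $\mathcal{H}$ be a $\beta$-acyclic hypergraph with vertex set $V=V(\mathcal{H})$ and let $<$ be a $\beta$-elimination order of $\mathcal{H}$. For every $x\in V$ and $e\in\mathcal{H}$, $$V(\mathcal{H}_e^x)\cap V_{\ge x}\subseteq e.$$
   Context: A hypergraph $\mathcal{H}$ is a finite set of finite sets (edges), with vertex set $V(\mathcal{H})=\bigcup_{e\in\mathcal{H}}e$. A $\beta$-elimination order of $\mathcal{H}$ is an order $x_1<\dots<x_n$ of $V(\mathcal{H})$ such that for all $i\le n$ and all $e,f\in\mathcal{H}$ with $x_i\in e\cap f$, either $e\setminus\{x_1,\dots,x_i\}\subseteq f$ or $f\setminus\{x_1,\dots,x_i\}\subseteq e$; $\mathcal{H}$ is $\beta$-acyclic if it has such an order. Write $V_{\ge x}=\{y\in V\mid y\ge x\}$. The edges are totally ordered by: $e<_{\mathcal{H}}f$ if and only if $e\neq f$ and $\max(e\,\Delta\,f)\in f$ (maximum with respect to $<$). A walk from edge $e$ to edge $f$ is a sequence $(e_1,x_1,e_2,\dots,x_m,e_{m+1})$ ($m\ge 0$) of edges and vertices with $e_1=e$, $e_{m+1}=f$ and $x_i\in e_i\cap e_{i+1}$ for all $i\le m$. For $x\in V$ and $e\in\mathcal{H}$, $\mathcal{H}_e^x\subseteq\mathcal{H}$ is the set of edges $f\in\mathcal{H}$ such that there is a walk from $f$ to $e$ using only edges $\le_{\mathcal{H}}e$ and only vertices (as connecting vertices $x_i$ of the walk) $\le x$; the edges $f$ themselves may contain vertices larger than $x$. -}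

module Defs where

open import Data.Fin.Base using (Fin) renaming (_≤_ to _≤ᶠ_)
open import Data.Fin.Subset using (Subset; _─_; _∪_) renaming (_∈_ to _∈ₑ_)
open import Data.List.Base using (List; []; _∷_)
open import Data.List.Membership.Propositional using () renaming (_∈_ to _∈ₗ_)
open import Data.List.Relation.Unary.All using (All)
open import Data.Nat.Base using (ℕ)
open import Data.Product.Base using (Σ-syntax; ∃-syntax; _×_)
open import Data.Sum.Base using (_⊎_)
open import Function.Bundles using (_⇔_)
open import Function.Definitions using (Injective)
open import Level using (0ℓ)
open import Relation.Binary.PropositionalEquality using (_≡_; _≢_)
open import Relation.Unary using (Pred; _∈_; _∩_; _⊆_; _∖_)

-- The elements of edges are drawn from a finite ground set Fin N, which may
-- contain points lying in no edge. A list represents the set of its entries: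
-- every notion below depends only on membership, so order and repetitions in
-- the list are irrelevant.
Hypergraph : ℕ → Set
Hypergraph N = List (Subset N)

⟦_⟧ : ∀ {N} → Subset N → Pred (Fin N) 0ℓ
⟦ e ⟧ v = v ∈ₑ e

edgesOf : ∀ {N} → Hypergraph N → Pred (Subset N) 0ℓ
edgesOf H e = e ∈ₗ H

V : ∀ {N} → Pred (Subset N) 0ℓ → Pred (Fin N) 0ℓ
V {N} F v = ∃[ e ] e ∈ F × v ∈ ⟦ e ⟧

_Δ_ : ∀ {N} → Subset N → Subset N → Subset N
e Δ f = (e ─ f) ∪ (f ─ e)

-- An order x₁ < … < xₙ is given by its enumeration σ, with σ i in the role
-- of xᵢ.
module _ {N n : ℕ} (σ : Fin n → Fin N) where

  initial : Fin n → Pred (Fin N) 0ℓ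
  initial i v = ∃[ j ] j ≤ᶠ i × σ j ≡ v

  _≤ᵥ_ : Fin N → Fin N → Set
  u ≤ᵥ v = ∃[ i ] ∃[ j ] σ i ≡ u × σ j ≡ v × i ≤ᶠ j

  IsMax : Pred (Fin N) 0ℓ → Fin N → Set
  IsMax P m = m ∈ P × (∀ {v} → v ∈ P → v ≤ᵥ m)

  _<ₑ_ : Subset N → Subset N → Set
  e <ₑ f = e ≢ f × (∃[ m ] IsMax ⟦ e Δ f ⟧ m × m ∈ ⟦ f ⟧)

  _≤ₑ_ : Subset N → Subset N → Set
  e ≤ₑ f = e ≡ f ⊎ e <ₑ f

record IsβEliminationOrder {N n : ℕ} (H : Hypergraph N) (σ : Fin n → Fin N) : Set where
  field
    injective   : Injective _≡_ _≡_ σ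
    enumerates  : ∀ v → v ∈ V (edgesOf H) ⇔ (∃[ i ] σ i ≡ v)
    elimination : ∀ i {e f} → e ∈ edgesOf H → f ∈ edgesOf H → σ i ∈ ⟦ e ⟧ ∩ ⟦ f ⟧ →
                  (⟦ e ⟧ ∖ initial σ i ⊆ ⟦ f ⟧) ⊎ (⟦ f ⟧ ∖ initial σ i ⊆ ⟦ e ⟧)

IsβAcyclic : ∀ {N} → Hypergraph N → Set
IsβAcyclic {N} H = ∃[ n ] Σ[ σ ∈ (Fin n → Fin N) ] IsβEliminationOrder H σ

data Walk {N : ℕ} (H : Hypergraph N) : Subset N → Subset N → Set where
  stop : ∀ {e} → e ∈ edgesOf H → Walk H e e
  step : ∀ {e f g} → e ∈ edgesOf H → (x : Fin N) → x ∈ ⟦ e ⟧ ∩ ⟦ f ⟧ →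
         Walk H f g → Walk H e g

module _ {N : ℕ} {H : Hypergraph N} where

  walkEdges : ∀ {e f} → Walk H e f → List (Subset N)
  walkEdges (stop {e} _)       = e ∷ []
  walkEdges (step {e} _ _ _ w) = e ∷ walkEdges w

  walkVertices : ∀ {e f} → Walk H e f → List (Fin N)
  walkVertices (stop _)       = []
  walkVertices (step _ x _ w) = x ∷ walkVertices w

module _ {N n : ℕ} (H : Hypergraph N) (σ : Fin n → Fin N) where

  V≥ : Fin N → Pred (Fin N) 0ℓ
  V≥ x y = y ∈ V (edgesOf H) × _≤ᵥ_ σ x y

  -- The subhypergraph 𝓗ₑˣ.
  component : Subset N → Fin N → Pred (Subset N) 0ℓ
  component e x f = f ∈ edgesOf H ×
    (Σ[ w ∈ Walk H f e ] All (λ g → _≤ₑ_ σ g e) (walkEdges w)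
                       × All (λ y → _≤ᵥ_ σ y x) (walkVertices w))

{-# OPTIONS --safe #-}
-- If two edges share x, the elimination condition makes one of them contain
-- the other on the vertices ≥ x. Hence a walk to e can be reduced to one along
-- which edges only grow on the vertices ≥ the connecting vertex: when an
-- intermediate edge f is contained in both its neighbours in this sense, the
-- larger of its two connecting vertices lies in both neighbours, so f can be
-- skipped. Along a reduced walk with connecting vertices ≤ x, a vertex ≥ x
-- propagates to e. The bound g ≤ₑ e on the edges of the walk is needed only to
-- orient the step into e.
module Submission where

open import Defs
open import Data.Fin.Base using (Fin) renaming (_≤_ to _≤ᶠ_)
open import Data.Fin.Properties using (≤-trans; ≤-antisym; ≤-total; _≤?_)
open import Data.Fin.Subset using (Subset; _─_)
open import Data.Fin.Subset.Properties
  using (_∈?_; x∈p∧x∉q⇒x∈p─q; x∈p∪q⁺; x∈p∪q⁻)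
open import Data.List.Relation.Unary.All using (All; _∷_)
open import Data.Nat.Base using (ℕ)
open import Data.Product.Base using (_,_)
open import Data.Sum.Base using (_⊎_; inj₁; inj₂)
import Data.Sum.Base as Sum
open import Data.Vec.Base using (_∷_; there)
open import Relation.Binary.PropositionalEquality using (refl; subst)
open import Relation.Nullary using (yes; no; contradiction)
open import Relation.Unary using (_∈_; _∉_; _∩_; _⊆_; _∖_)

x∈p─q⇒x∉q : ∀ {N} (p q : Subset N) {x} → x ∈ ⟦ p ─ q ⟧ → x ∉ ⟦ q ⟧
x∈p─q⇒x∉q (_ ∷ p) (_ ∷ q) (there x∈) (there x∈q) = x∈p─q⇒x∉q p q x∈ x∈q

x∈pΔq∧x∈q⇒x∉p : ∀ {N} (p q : Subset N) {x} → x ∈ ⟦ p Δ q ⟧ → x ∈ ⟦ q ⟧ → x ∉ ⟦ p ⟧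
x∈pΔq∧x∈q⇒x∉p p q x∈ x∈q x∈p with x∈p∪q⁻ (p ─ q) (q ─ p) x∈
... | inj₁ x∈p─q = x∈p─q⇒x∉q p q x∈p─q x∈q
... | inj₂ x∈q─p = x∈p─q⇒x∉q q p x∈q─p x∈p

module _ {N n : ℕ} {H : Hypergraph N} {σ : Fin n → Fin N}
         (order : IsβEliminationOrder H σ) where

  open IsβEliminationOrder order

  ContainedFrom : Fin n → Subset N → Subset N → Set
  ContainedFrom j f g = ∀ {k} → j ≤ᶠ k → σ k ∈ ⟦ f ⟧ → σ k ∈ ⟦ g ⟧

  -- `initial σ j` contains `σ j` itself, so position `j` has to be supplied by the assumption on
  -- `g`.
  ∖initial⇒containedFrom : ∀ {j f g} → σ j ∈ ⟦ g ⟧ →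
    ⟦ f ⟧ ∖ initial σ j ⊆ ⟦ g ⟧ → ContainedFrom j f g
  ∖initial⇒containedFrom {j} {f} {g} j∈g f⊆g {k} j≤k k∈f with k ≤? j
  ... | yes k≤j = subst (λ i → σ i ∈ ⟦ g ⟧) (≤-antisym j≤k k≤j) j∈g
  ... | no  k≰j = f⊆g (k∈f , λ { (l , l≤j , σl≡σk) →
                    k≰j (subst (_≤ᶠ j) (injective σl≡σk) l≤j) })

  containedFrom-total : ∀ j {f g} → f ∈ edgesOf H → g ∈ edgesOf H →
    σ j ∈ ⟦ f ⟧ ∩ ⟦ g ⟧ → ContainedFrom j f g ⊎ ContainedFrom j g f
  containedFrom-total j f∈H g∈H j∈@(j∈f , j∈g) =
    Sum.map (∖initial⇒containedFrom j∈g) (∖initial⇒containedFrom j∈f)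
            (elimination j f∈H g∈H j∈)

  -- If the containment went the other way and were strict, the maximum of `g Δ e` would lie at a
  -- position ≥ `j` and in `e`, hence in `g` too, which is absurd.
  ≤ₑ⇒containedFrom : ∀ {j g e} → g ∈ edgesOf H → e ∈ edgesOf H →
    σ j ∈ ⟦ g ⟧ ∩ ⟦ e ⟧ → _≤ₑ_ σ g e → ContainedFrom j g e
  ≤ₑ⇒containedFrom _ _ _ (inj₁ refl) _ k∈g = k∈g
  ≤ₑ⇒containedFrom {j} {g} {e} g∈H e∈H j∈@(_ , j∈e) (inj₂ (_ , m , (m∈Δ , max) , m∈e))
    with containedFrom-total j g∈H e∈H j∈
  ... | inj₁ g⊆e = g⊆e
  ... | inj₂ e⊆g = go
    where
    go : ContainedFrom j g e
    go {k} j≤k k∈g with σ k ∈? e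
    ... | yes k∈e = k∈e
    ... | no  k∉e with max (x∈p∪q⁺ (inj₁ (x∈p∧x∉q⇒x∈p─q k∈g k∉e)))
    -- Here `σ b` is the maximum `m`, and `a` equals `k` by injectivity.
    ...   | a , b , σa≡σk , refl , a≤b =
      contradiction (e⊆g j≤b m∈e) (x∈pΔq∧x∈q⇒x∉p g e m∈Δ m∈e)
      where
      j≤b : j ≤ᶠ b
      j≤b = ≤-trans j≤k (subst (_≤ᶠ b) (injective σa≡σk) a≤b)

  data Ascent (i : Fin n) (e : Subset N) : Subset N → Set where
    stop : Ascent i e e
    step : ∀ {f g j} → g ∈ edgesOf H → j ≤ᶠ i → σ j ∈ ⟦ f ⟧ ∩ ⟦ g ⟧ →
           ContainedFrom j f g → Ascent i e g → Ascent i e f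

  ascent⇒containedFrom : ∀ {i e f} → Ascent i e f → ContainedFrom i f e
  ascent⇒containedFrom stop                      i≤k k∈f = k∈f
  ascent⇒containedFrom (step _ j≤i _ f⊆g ascent) i≤k k∈f =
    ascent⇒containedFrom ascent i≤k (f⊆g (≤-trans j≤i i≤k) k∈f)

  -- An edge `f` that is contained in `g` is dropped, and `g` is then compared with the next edge
  -- `h` of a shorter ascent.
  prepend : ∀ {i j e f g} → g ∈ edgesOf H → _≤ₑ_ σ g e → f ∈ edgesOf H →
    j ≤ᶠ i → σ j ∈ ⟦ g ⟧ ∩ ⟦ f ⟧ → Ascent i e f → Ascent i e g
  prepend g∈H g≤e f∈H j≤i j∈ stop =
    step f∈H j≤i j∈ (≤ₑ⇒containedFrom g∈H f∈H j∈ g≤e) stop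
  prepend {j = j} g∈H g≤e f∈H j≤i j∈@(j∈g , j∈f)
          ascent@(step {j = k} h∈H k≤i (k∈f , k∈h) f⊆h rest)
    with containedFrom-total j g∈H f∈H j∈
  ... | inj₁ g⊆f = step f∈H j≤i j∈ g⊆f ascent
  ... | inj₂ f⊆g with ≤-total j k
  -- The link between `g` and `h` is `σ k` here and `σ j` in the next case.
  ...   | inj₁ j≤k = prepend g∈H g≤e h∈H k≤i (f⊆g j≤k k∈f , k∈h) rest
  ...   | inj₂ k≤j = prepend g∈H g≤e h∈H j≤i (j∈g , f⊆h k≤j j∈f) rest

  source∈H : ∀ {f e} → Walk H f e → f ∈ edgesOf H
  source∈H (stop e∈H)       = e∈H
  source∈H (step f∈H _ _ _) = f∈H

  walk⇒ascent : ∀ {i e f} (w : Walk H f e) →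
    All (λ g → _≤ₑ_ σ g e) (walkEdges w) →
    All (λ y → _≤ᵥ_ σ y (σ i)) (walkVertices w) → Ascent i e f
  walk⇒ascent (stop _) _ _ = stop
  walk⇒ascent (step f∈H _ x∈ w) (f≤e ∷ w≤e) ((j , l , refl , σl≡σi , j≤l) ∷ w≤x) =
    prepend f∈H f≤e (source∈H w) (subst (j ≤ᶠ_) (injective σl≡σi) j≤l) x∈
            (walk⇒ascent w w≤e w≤x)

theorem3 : ∀ {N n : ℕ} (H : Hypergraph N) → IsβAcyclic H →
    (σ : Fin n → Fin N) → IsβEliminationOrder H σ →
    (x : Fin N) → x ∈ V (edgesOf H) → (e : Subset N) → e ∈ edgesOf H →
    V (component H σ e x) ∩ V≥ H σ x ⊆ ⟦ e ⟧
theorem3 H _ σ order _ _ e _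
  -- Membership in `V≥` presents `x` as `σ i` and the given vertex as `σ k`.
  ((f , (_ , w , w≤e , w≤x) , y∈f) , (_ , i , k , refl , refl , i≤k)) =
  ascent⇒containedFrom order (walk⇒ascent order w w≤e w≤x) i≤k y∈f
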